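{- Let $G$ be a non-supergraceful graph having a semitotal labeling $\varphi$ with $1 \in N(\varphi)$. Then there is a connected supergraceful graph $H$ containing an induced subgraph isomorphic to $G$.
   Context: Graphs are finite, simple. For a labeling $\varphi: V(G) \to \mathbb{Z}_{>0}$ let $N(\varphi) = \{\varphi(x) : x \in V(G)\}$ and $E(\varphi) = \{|\varphi(x)-\varphi(y)| : xy \in E(G)\}$. A total labeling of a graph with $p$ nodes and $q$ edges is a map $\varphi$ such that the $p$ node labels and $q$ edge labels are pairwise distinct and $N(\varphi) \cup E(\varphi) = \{1,\dots,p+q\}$; a graph is supergraceful if it has one, non-supergraceful otherwise. For non-supergraceful $G$, let $q_0>0$ be the least integer such that there is a labeling with all node and edge labels pairwise distinct and $N(\varphi)\cup E(\varphi) \subseteq \{1,\dots,p+q+q_0\}$; such a labeling is a semitotal labeling. -}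

module Defs where

open import Data.Nat using (ℕ; _+_; _≤_; _<_; ∣_-_∣)
open import Data.Fin using (Fin)
import Data.Fin as Fin
import Data.Fin.Properties as Fin
open import Data.Fin.Subset using (Subset) renaming (_∈_ to _∈ˢ_)
open import Data.List using (List; map; length; filter; allFin; cartesianProduct; _++_)
open import Data.List.Membership.Propositional using (_∈_)
open import Data.List.Relation.Unary.Unique.Propositional using (Unique)
open import Data.Product using (∃-syntax; _×_; _,_; proj₁)
open import Function.Bundles using (_↔_; _⇔_; Inverse)
open import Level using (0ℓ)
open import Relation.Binary using (Rel; Symmetric; Irreflexive; Decidable)
open import Relation.Binary.Construct.Closure.ReflexiveTransitive using (Star)
open import Relation.Binary.PropositionalEquality using (_≡_)
open import Relation.Nullary.Decidable using (_×-dec_)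

record Graph : Set₁ where
  field
    order    : ℕ
    _~_      : Rel (Fin order) 0ℓ
    ~-sym    : Symmetric _~_
    ~-irrefl : Irreflexive _≡_ _~_
    _~?_     : Decidable _~_

  Vertex : Set
  Vertex = Fin order

  -- Each edge is listed exactly once, with its smaller endpoint first.
  edges : List (Vertex × Vertex)
  edges = filter (λ (u , v) → (u Fin.<? v) ×-dec (u ~? v))
                 (cartesianProduct (allFin order) (allFin order))

  size : ℕ
  size = length edges

open Graph public using (order; Vertex; edges; size)

Connected : Graph → Set
Connected G = 0 < order G × (∀ u v → Star (Graph._~_ G) u v)

-- An isomorphism from G onto the subgraph of H induced by the vertex set S.
record InducedIso (G H : Graph) (S : Subset (order H)) : Set where
  field
    bijection : Vertex G ↔ (∃[ v ] v ∈ˢ S)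

  embed : Vertex G → Vertex H
  embed u = proj₁ (Inverse.to bijection u)

  field
    adjacency : ∀ u v → Graph._~_ G u v ⇔ Graph._~_ H (embed u) (embed v)

ContainsInduced : Graph → Graph → Set
ContainsInduced H G = ∃[ S ] InducedIso G H S

record Labeling (G : Graph) : Set where
  field
    label    : Vertex G → ℕ
    positive : ∀ v → 0 < label v

open Labeling public using (label)

module _ {G : Graph} (φ : Labeling G) where

  nodeLabels : List ℕ
  nodeLabels = map (label φ) (allFin (order G))

  edgeLabels : List ℕ
  edgeLabels = map (λ (u , v) → ∣ label φ u - label φ v ∣) (edges G)

  -- These lists keep multiplicities, so Unique below says that all the node
  -- and edge labels are pairwise distinct.
  labels : List ℕ
  labels = nodeLabels ++ edgeLabels

  IsTotal : Set
  IsTotal = Unique labels × (∀ k → k ∈ labels ⇔ (1 ≤ k × k ≤ order G + size G))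

  DistinctWithin : ℕ → Set
  DistinctWithin m = Unique labels × (∀ k → k ∈ labels → 1 ≤ k × k ≤ m)

Supergraceful : Graph → Set
Supergraceful G = ∃[ φ ] IsTotal {G} φ

Admits : Graph → ℕ → Set
Admits G r = ∃[ φ ] DistinctWithin {G} φ (order G + size G + r)

IsLeastExcess : Graph → ℕ → Set
IsLeastExcess G q₀ = 0 < q₀ × Admits G q₀ × (∀ r → 0 < r → Admits G r → q₀ ≤ r)

-- Meaningful for non-supergraceful G only.
IsSemitotal : {G : Graph} → Labeling G → Set
IsSemitotal {G} φ =
  ∃[ q₀ ] IsLeastExcess G q₀ × DistinctWithin φ (order G + size G + q₀)

{-# OPTIONS --safe #-}
{-
Work with labels in place of vertices.  Adding every unused label up to an even
bound c, larger than all labels of φ, as an isolated node fills {1,…,c}.  If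
{1,…,t} is filled, two consecutive labels t+1, t+2 can be used up by a new node
t+2 joined to 1.  Nodes x < y with x odd and y even can therefore be connected:
take a new node N = t+1+y adjacent to both; its edges are labelled N−y = t+1 and
N−x, and the even numbers y−x−1 and x−1 of labels left between N−y, N−x and N are
used up in consecutive pairs.  Joining 1 to c, then each even node to 1 and each
odd node to c, makes everything connected without adding edges between old nodes.
-}
module Submission where

open import Defs
open import Data.Empty using (⊥-elim)
open import Data.Fin using (zero; suc)
import Data.Fin as Fin
import Data.Fin.Properties as Fin
open import Data.List using (List; []; _∷_; [_]; _++_; map; length; lookup; filter; allFin; cartesianProduct; applyDownFrom)
open import Data.List.Properties using (map-∘; map-++; map-tabulate; tabulate-lookup; length-applyDownFrom; length-++; length-map; ++-assoc)
open import Data.List.Membership.Propositional using (_∈_; _∉_)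
open import Data.List.Membership.Propositional.Properties
open import Data.List.Relation.Binary.BagAndSetEquality using (∼bag⇒↭)
open import Data.List.Membership.Propositional.Properties.WithK using (unique∧set⇒bag)
open import Data.List.Relation.Binary.Permutation.Propositional using (_↭_; prep; ↭-refl; ↭-sym; ↭-reflexive; ↭⇒↭ₛ; module PermutationReasoning)
open import Data.List.Relation.Binary.Permutation.Propositional.Properties using (∈-resp-↭; ↭-length; shift; shifts; ++⁺ˡ; ++⁺ʳ; ++-comm)
import Data.List.Relation.Binary.Permutation.Setoid.Properties as ↭ₛ
open import Data.List.Relation.Binary.Subset.Propositional using (_⊆_)
open import Data.List.Relation.Unary.All as All using (All; []; _∷_)
open import Data.List.Relation.Unary.AllPairs using ([]; _∷_)
open import Data.List.Relation.Unary.Any using (here; there; index)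
open import Data.List.Relation.Unary.Any.Properties using (lookup-index)
open import Data.List.Relation.Unary.Unique.Propositional using (Unique)
import Data.List.Relation.Unary.Unique.Propositional.Properties as Unique
open import Data.Nat using (ℕ; zero; suc; _+_; _*_; _≤_; _<_; z≤n; s≤s; ∣_-_∣)
open import Data.Nat.Properties hiding (_≟_)
import Data.Nat.Properties as ℕ
open import Data.Nat.Solver using (module +-*-Solver)
open import Data.Product using (Σ; ∃-syntax; _×_; _,_; proj₁; proj₂)
open import Data.Product.Properties using (≡-dec; ,-injective)
open import Data.Sum using (inj₁; inj₂; [_,_]′)
open import Data.Bool using (true)
import Data.Vec as Vec
import Data.Vec.Properties as Vec
open import Data.Vec.Properties.WithK using ([]=-irrelevant)
open import Data.Fin.Subset using (Subset)
open import Function using (_∘_; id; _⇔_; mk⇔; Equivalence; mk↔ₛ′)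
open import Relation.Binary.Construct.Closure.Equivalence as Eq using (EqClosure)
open import Relation.Binary.Construct.Closure.ReflexiveTransitive using (Star; ε; _◅_)
open import Relation.Binary.Construct.Closure.Symmetric using (SymClosure; fwd; bwd)
import Relation.Binary.Construct.Closure.Symmetric as Sym
open import Relation.Binary.Definitions using (tri<; tri≈; tri>)
open import Relation.Binary.PropositionalEquality hiding ([_])
open import Relation.Nullary using (¬_; Dec; yes; no; does)
open import Relation.Nullary.Decidable using (dec-true; _×-dec_; _⊎-dec_; ¬?; map′)
open import Data.List.Membership.DecPropositional ℕ._≟_ using (_∈?_)
import Data.List.Membership.DecPropositional (≡-dec ℕ._≟_ ℕ._≟_) as Pair

-- Lists without repetition.

module _ {a} {A : Set a} where

  lookup-injective : ∀ {xs : List A} → Unique xs → ∀ {i j} → lookup xs i ≡ lookup xs j → i ≡ j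
  lookup-injective (_ ∷ _)  {zero}  {zero}  _  = refl
  lookup-injective (x∉ ∷ _) {zero}  {suc j} eq = ⊥-elim (All.lookup x∉ (∈-lookup j) eq)
  lookup-injective (x∉ ∷ _) {suc i} {zero}  eq = ⊥-elim (All.lookup x∉ (∈-lookup i) (sym eq))
  lookup-injective (_ ∷ u)  {suc i} {suc j} eq = cong suc (lookup-injective u eq)

  Unique-++⁻ˡ : ∀ (xs : List A) {ys} → Unique (xs ++ ys) → Unique xs
  Unique-++⁻ˡ []       _        = []
  Unique-++⁻ˡ (x ∷ xs) (x∉ ∷ u) = All.tabulate (All.lookup x∉ ∘ ∈-++⁺ˡ) ∷ Unique-++⁻ˡ xs u

  Unique-++⁻ʳ : ∀ (xs : List A) {ys} → Unique (xs ++ ys) → Unique ys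
  Unique-++⁻ʳ []       u       = u
  Unique-++⁻ʳ (x ∷ xs) (_ ∷ u) = Unique-++⁻ʳ xs u

  Unique-resp-↭ : ∀ {xs ys : List A} → xs ↭ ys → Unique xs → Unique ys
  Unique-resp-↭ p = ↭ₛ.Unique-resp-↭ (setoid A) (↭⇒↭ₛ p)

  unique∧set⇒↭ : ∀ {xs ys : List A} → Unique xs → Unique ys →
                 (∀ {z} → z ∈ xs → z ∈ ys) → (∀ {z} → z ∈ ys → z ∈ xs) → xs ↭ ys
  unique∧set⇒↭ u v to from = ∼bag⇒↭ (unique∧set⇒bag u v (mk⇔ to from))

module _ {a b} {A : Set a} {B : Set b} {f : A → B} where

  -- Injectivity is asked on members only: the difference map separates the listed edges of a graph,
  -- but not arbitrary pairs of vertices.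
  Unique-map⁺ : ∀ {xs} → (∀ {x y} → x ∈ xs → y ∈ xs → f x ≡ f y → x ≡ y) →
                Unique xs → Unique (map f xs)
  Unique-map⁺ inj []       = []
  Unique-map⁺ inj (x∉ ∷ u) =
    All.tabulate (λ y∈ fx≡y → let z , z∈ , y≡fz = ∈-map⁻ f y∈ in
      All.lookup x∉ z∈ (inj (here refl) (there z∈) (trans fx≡y y≡fz)))
    ∷ Unique-map⁺ (λ x∈ y∈ → inj (there x∈) (there y∈)) u

  Unique-map-injective : ∀ {xs x y} → Unique (map f xs) → x ∈ xs → y ∈ xs → f x ≡ f y → x ≡ y
  Unique-map-injective u        (here refl) (here refl) _  = refl
  Unique-map-injective (x∉ ∷ _) (here refl) (there y∈)  eq = ⊥-elim (All.lookup x∉ (∈-map⁺ f y∈) eq)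
  Unique-map-injective (x∉ ∷ _) (there x∈)  (here refl) eq = ⊥-elim (All.lookup x∉ (∈-map⁺ f x∈) (sym eq))
  Unique-map-injective (_ ∷ u)  (there x∈)  (there y∈)  eq = Unique-map-injective u x∈ y∈ eq

-- Edge lists and induced subgraphs.

∈-edges : ∀ (G : Graph) {u v} → (u , v) ∈ edges G ⇔ (u Fin.< v × Graph._~_ G u v)
∈-edges G {u} {v} = mk⇔
  (λ e → proj₂ (∈-filter⁻ edge? {xs = pairs} e))
  (λ p → ∈-filter⁺ edge? (∈-cartesianProduct⁺ (∈-allFin u) (∈-allFin v)) p)
  where
  pairs = cartesianProduct (allFin (order G)) (allFin (order G))
  edge? = λ ((u , v) : Vertex G × Vertex G) → (u Fin.<? v) ×-dec Graph._~?_ G u v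

edges-unique : ∀ (G : Graph) → Unique (edges G)
edges-unique G = Unique.filter⁺ _ (Unique.cartesianProduct⁺ (Unique.allFin⁺ _) (Unique.allFin⁺ _))

witness : ∀ {p} {P : Set p} (P? : Dec P) → does P? ≡ true → P
witness (yes p) _ = p

-- The image of `f` is cut out by the decidable search for a preimage, and the same search, read
-- back from a membership proof, supplies the inverse map.
embedding⇒ContainsInduced : ∀ {G H : Graph} (f : Vertex G → Vertex H) →
  (∀ {u v} → f u ≡ f v → u ≡ v) →
  (∀ u v → Graph._~_ G u v ⇔ Graph._~_ H (f u) (f v)) → ContainsInduced H G
embedding⇒ContainsInduced {G} {H} f f-injective adj = image , record
  { bijection = mk↔ₛ′ (λ u → f u , ∈-image u) (λ (v , v∈) → proj₁ (preimage v∈))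
      (λ (v , v∈) → to∘from v∈ (preimage v∈))
      (λ u → f-injective (proj₂ (preimage (∈-image u))))
  ; adjacency = adj
  }
  where
  hit? : ∀ v → Dec (∃[ u ] f u ≡ v)
  hit? v = Fin.any? (λ u → f u Fin.≟ v)

  image : Subset (order H)
  image = Vec.tabulate (λ v → does (hit? v))

  ∈-image : ∀ u → image Vec.[ f u ]= true
  ∈-image u = Vec.lookup⇒[]= (f u) image
    (trans (Vec.lookup∘tabulate _ (f u)) (dec-true (hit? (f u)) (u , refl)))

  preimage : ∀ {v} → image Vec.[ v ]= true → ∃[ u ] f u ≡ v
  preimage {v} v∈ = witness (hit? v) (trans (sym (Vec.lookup∘tabulate _ v)) (Vec.[]=⇒lookup v∈))

  to∘from : ∀ {v} (v∈ : image Vec.[ v ]= true) ((u , _) : ∃[ u ] f u ≡ v) → (f u , ∈-image u) ≡ (v , v∈)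
  -- Membership proofs for a fixed vertex are all equal, so agreement of the vertices suffices.
  to∘from v∈ (u , refl) = cong (f u ,_) ([]=-irrelevant _ _)

-- Filled segments and partial constructions.

segment : ℕ → List ℕ
-- Listing downwards makes `segment (suc n)` reduce to `suc n ∷ segment n`, so that using the next
-- label is a single `prep`.
segment = applyDownFrom suc

∈-segment : ∀ {k n} → k ∈ segment n ⇔ (1 ≤ k × k ≤ n)
∈-segment = mk⇔ to from
  where
  to : ∀ {k n} → k ∈ segment n → 1 ≤ k × k ≤ n
  to k∈ with _ , i<n , refl ← ∈-applyDownFrom⁻ suc k∈ = s≤s z≤n , i<n
  from : ∀ {k n} → 1 ≤ k × k ≤ n → k ∈ segment n
  from {suc k} (_ , k<n) = ∈-applyDownFrom⁺ suc k<n

segment-unique : ∀ n → Unique (segment n)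
segment-unique n = Unique.applyDownFrom⁺₁ suc n (λ j<i _ eq → <⇒≢ j<i (sym (suc-injective eq)))

dist : ℕ × ℕ → ℕ
dist (x , y) = ∣ x - y ∣

Arc : List (ℕ × ℕ) → ℕ → ℕ → Set
Arc es x y = (x , y) ∈ es

-- Vertices are identified with their labels.  The list gaps holds labels that
-- are set aside for edges whose larger endpoint has not been added yet.
record Scheme (gaps : List ℕ) : Set where
  field
    nodes     : List ℕ
    arcs      : List (ℕ × ℕ)
    top       : ℕ
    fills     : gaps ++ nodes ++ map dist arcs ↭ segment top
    endpoints : ∀ {x y} → (x , y) ∈ arcs → x ∈ nodes × y ∈ nodes
    1∈nodes   : 1 ∈ nodes

open Scheme

Linked : ∀ {gaps} → Scheme gaps → ℕ → ℕ → Set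
Linked C = EqClosure (Arc (arcs C))

infix 4 _⊑_

-- `D` arises from `C` by steps that add arcs only towards a fresh node, stored second and labelled
-- above `top C`. Thus `induced` keeps the old graph an induced subgraph. By `hangs` no added node
-- starts a component of its own, so connecting the old nodes connects everything.
record _⊑_ {gaps gaps′} (C : Scheme gaps) (D : Scheme gaps′) : Set where
  field
    top≤    : top C ≤ top D
    nodes⊆  : nodes C ⊆ nodes D
    arcs⊆   : arcs C ⊆ arcs D
    induced : ∀ {x y} → (x , y) ∈ arcs D → y ≤ top C → (x , y) ∈ arcs C
    hangs   : ∀ {y} → y ∈ nodes D → ∃[ x ] x ∈ nodes C × Linked D x y

open _⊑_

⊑-refl : ∀ {gaps} {C : Scheme gaps} → C ⊑ C
⊑-refl = record
  { top≤ = ≤-refl ; nodes⊆ = id ; arcs⊆ = id ; induced = λ e _ → e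
  ; hangs = λ y∈ → _ , y∈ , ε }

Linked-mono : ∀ {gaps gaps′} {C : Scheme gaps} {D : Scheme gaps′} → C ⊑ D →
              ∀ {x y} → Linked C x y → Linked D x y
Linked-mono C⊑D = Eq.map (arcs⊆ C⊑D)

⊑-trans : ∀ {xs ys zs} {C : Scheme xs} {D : Scheme ys} {E : Scheme zs} → C ⊑ D → D ⊑ E → C ⊑ E
⊑-trans C⊑D D⊑E = record
  { top≤    = ≤-trans (top≤ C⊑D) (top≤ D⊑E)
  ; nodes⊆  = nodes⊆ D⊑E ∘ nodes⊆ C⊑D
  ; arcs⊆   = arcs⊆ D⊑E ∘ arcs⊆ C⊑D
  ; induced = λ e y≤ → induced C⊑D (induced D⊑E e (≤-trans y≤ (top≤ C⊑D))) y≤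
  ; hangs   = λ z∈ → let y , y∈ , y~z = hangs D⊑E z∈
                         x , x∈ , x~y = hangs C⊑D y∈
                     in x , x∈ , Eq.transitive _ (Linked-mono D⊑E x~y) y~z
  }

reserve : ∀ {gaps} (C : Scheme gaps) → Scheme (suc (top C) ∷ gaps)
reserve C = record
  { nodes = nodes C ; arcs = arcs C ; top = suc (top C)
  ; fills = prep _ (fills C) ; endpoints = endpoints C ; 1∈nodes = 1∈nodes C }

⊑-reserve : ∀ {gaps} (C : Scheme gaps) → C ⊑ reserve C
⊑-reserve C = record
  { top≤ = n≤1+n _ ; nodes⊆ = id ; arcs⊆ = id ; induced = λ e _ → e
  ; hangs = λ y∈ → _ , y∈ , ε }

-- Adding a node with prescribed neighbours.

module _ {gaps gaps′ : List ℕ} (C : Scheme gaps) (d : ℕ) (ds : List ℕ) where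

  private
    new : ℕ
    new = suc (top C)

    newArcs : List (ℕ × ℕ)
    newArcs = map (_, new) (d ∷ ds)

    diffs : List ℕ
    diffs = map (λ x → ∣ x - new ∣) (d ∷ ds)

    ∈-newArcs⁻ : ∀ {x y} → (x , y) ∈ newArcs → x ∈ d ∷ ds × y ≡ new
    ∈-newArcs⁻ e with x , x∈ , refl ← ∈-map⁻ (_, new) e = x∈ , refl

    -- The labels `diffs` merely change role, from gaps to differences of arcs; `new` is the only
    -- label that enters.
    attached-fills : gaps ↭ diffs ++ gaps′ →
                     gaps′ ++ (new ∷ nodes C) ++ map dist (newArcs ++ arcs C) ↭ segment new
    attached-fills gaps↭ = begin
      gaps′ ++ (new ∷ nodes C) ++ map dist (newArcs ++ arcs C)
        ↭⟨ shift new gaps′ _ ⟩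
      new ∷ gaps′ ++ nodes C ++ map dist (newArcs ++ arcs C)
        ≡⟨ cong (λ l → new ∷ gaps′ ++ nodes C ++ l) (map-++ dist newArcs (arcs C)) ⟩
      new ∷ gaps′ ++ nodes C ++ map dist newArcs ++ old
        ≡⟨ cong (λ l → new ∷ gaps′ ++ nodes C ++ l ++ old) (sym (map-∘ {g = dist} {f = _, new} (d ∷ ds))) ⟩
      new ∷ gaps′ ++ nodes C ++ diffs ++ old
        ↭⟨ prep new (++⁺ˡ gaps′ (shifts (nodes C) diffs)) ⟩
      new ∷ gaps′ ++ diffs ++ nodes C ++ old
        ↭⟨ prep new (shifts gaps′ diffs) ⟩
      new ∷ diffs ++ gaps′ ++ nodes C ++ old
        ≡⟨ cong (new ∷_) (sym (++-assoc diffs gaps′ _)) ⟩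
      new ∷ (diffs ++ gaps′) ++ nodes C ++ old
        ↭⟨ prep new (++⁺ʳ (nodes C ++ old) (↭-sym gaps↭)) ⟩
      new ∷ gaps ++ nodes C ++ old
        ↭⟨ prep new (fills C) ⟩
      segment new ∎
      where
      open PermutationReasoning
      old : List ℕ
      old = map dist (arcs C)

    attached-endpoints : d ∷ ds ⊆ nodes C → ∀ {x y} → (x , y) ∈ newArcs ++ arcs C →
                         x ∈ new ∷ nodes C × y ∈ new ∷ nodes C
    attached-endpoints ds⊆ e with ∈-++⁻ newArcs e
    ... | inj₁ e∈ = there (ds⊆ (proj₁ (∈-newArcs⁻ e∈))) , here (proj₂ (∈-newArcs⁻ e∈))
    ... | inj₂ e∈ = there (proj₁ (endpoints C e∈)) , there (proj₂ (endpoints C e∈))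

    attached-induced : ∀ {x y} → (x , y) ∈ newArcs ++ arcs C → y ≤ top C → (x , y) ∈ arcs C
    attached-induced e y≤ with ∈-++⁻ newArcs e
    ... | inj₁ e∈ = ⊥-elim (<-irrefl (proj₂ (∈-newArcs⁻ e∈)) (s≤s y≤))
    ... | inj₂ e∈ = e∈

  -- The new node takes the label after `top C`, and its arcs must consume gaps equal to their
  -- differences. The neighbour list is nonempty so that the node hangs on the old node `d`.
  attach : d ∷ ds ⊆ nodes C → gaps ↭ diffs ++ gaps′ →
           Σ (Scheme gaps′) λ D → C ⊑ D × top D ≡ new × newArcs ⊆ arcs D
  attach ds⊆ gaps↭ = D , C⊑D , refl , ∈-++⁺ˡ
    where
    D : Scheme gaps′
    D .nodes     = new ∷ nodes C
    D .arcs      = newArcs ++ arcs C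
    D .top       = new
    D .fills     = attached-fills gaps↭
    D .endpoints = attached-endpoints ds⊆
    D .1∈nodes   = there (1∈nodes C)

    hanging : ∀ {y} → y ∈ new ∷ nodes C → ∃[ x ] x ∈ nodes C × EqClosure (Arc (newArcs ++ arcs C)) x y
    hanging (here refl) = d , ds⊆ (here refl) , Eq.return (here refl)
    hanging (there y∈)  = _ , y∈ , ε

    C⊑D : C ⊑ D
    C⊑D .top≤    = n≤1+n _
    C⊑D .nodes⊆  = there
    C⊑D .arcs⊆   = ∈-++⁺ʳ newArcs
    C⊑D .induced = attached-induced
    C⊑D .hangs   = hanging

-- Leaves at 1, and paths from an odd node to a larger even one.

leaf : ∀ {gaps} (C : Scheme gaps) → Σ (Scheme gaps) λ D → C ⊑ D × top D ≡ 2 + top C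
-- The difference between 1 and the new node `2 + top C` computes to the label just reserved, hence
-- `↭-refl`.
leaf C with attach (reserve C) 1 [] (λ { (here refl) → 1∈nodes C }) ↭-refl
... | D , C′⊑D , eq , _ = D , ⊑-trans (⊑-reserve C) C′⊑D , eq

leaves : ∀ n {gaps} (C : Scheme gaps) → Σ (Scheme gaps) λ D → C ⊑ D × top D ≡ n * 2 + top C
leaves zero    C = C , ⊑-refl , refl
leaves (suc n) C with leaves n C
... | D , C⊑D , eq with leaf D
... | E , D⊑E , eq′ = E , ⊑-trans C⊑D D⊑E , trans eq′ (cong (2 +_) eq)

-- The parameters encode the parities and the order of the ends `x` and `y` without subtraction: x -
-- 1 is `i * 2` and y - x - 1 is `j * 2`, which are the amounts of labels that `i` and `j` leaves
-- use up.
join : (C : Scheme []) (i j : ℕ) → 1 + i * 2 ∈ nodes C → 2 + (i + j) * 2 ∈ nodes C →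
       Σ (Scheme []) λ D → C ⊑ D × Linked D (1 + i * 2) (2 + (i + j) * 2)
-- For the node N attached at the end, the first label reserved is N - y. After `j` leaves the next
-- one is N - x, and `i` more leaves bring the top to N - 1.
join C i j x∈ y∈ with leaves j (reserve C)
... | C₂ , C₁⊑C₂ , top₂ with leaves i (reserve C₂)
... | C₄ , C₃⊑C₄ , top₄ = joined (attach C₄ x [ y ] ends⊆ gaps↭)
  where
  x y : ℕ
  x = 1 + i * 2
  y = 2 + (i + j) * 2

  C⊑C₄ : C ⊑ C₄
  C⊑C₄ = ⊑-trans (⊑-trans (⊑-reserve C) C₁⊑C₂) (⊑-trans (⊑-reserve C₂) C₃⊑C₄)

  ends⊆ : x ∷ [ y ] ⊆ nodes C₄
  ends⊆ (here refl)         = nodes⊆ C⊑C₄ x∈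
  ends⊆ (there (here refl)) = nodes⊆ C⊑C₄ y∈

  regroup : ∀ t → (1 + i * 2) + suc (j * 2 + suc t) ≡ (2 + (i + j) * 2) + suc t
  regroup t = solve 3 (λ i j t →
    (con 1 :+ i :* con 2) :+ (con 1 :+ (j :* con 2 :+ (con 1 :+ t)))
    := (con 2 :+ (i :+ j) :* con 2) :+ (con 1 :+ t)) refl i j t
    where open +-*-Solver

  new≡x+ : suc (top C₄) ≡ x + suc (top C₂)
  new≡x+ = cong suc top₄

  new≡y+ : suc (top C₄) ≡ y + suc (top C)
  new≡y+ = trans new≡x+ (trans (cong (λ t → x + suc t) top₂) (regroup (top C)))

  diff : ∀ m {N n} → N ≡ m + n → n ≡ ∣ m - N ∣
  diff m refl = sym (∣m-m+n∣≡n m _)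

  gaps↭ : suc (top C₂) ∷ [ suc (top C) ] ↭ ∣ x - suc (top C₄) ∣ ∷ [ ∣ y - suc (top C₄) ∣ ]
  gaps↭ = ↭-reflexive (cong₂ (λ m n → m ∷ [ n ]) (diff x new≡x+) (diff y new≡y+))

  joined : (Σ (Scheme []) λ D → C₄ ⊑ D × top D ≡ suc (top C₄) ×
             (x , suc (top C₄)) ∷ [ y , suc (top C₄) ] ⊆ arcs D) →
           Σ (Scheme []) λ D → C ⊑ D × Linked D x y
  joined (D , C₄⊑D , _ , new⊆) =
    D , ⊑-trans C⊑C₄ C₄⊑D , fwd (new⊆ (here refl)) ◅ bwd (new⊆ (there (here refl))) ◅ ε

-- Connecting all nodes.

data Parity (k : ℕ) : ℕ → Set where
  -- The complement `j` writes the even bound as `2 + (i + j) * 2`, the form of the larger end in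
  -- `join`. An even label is joined to 1 and needs no such datum.
  odd  : ∀ i {j} → i + j ≡ k → Parity k (1 + i * 2)
  even : ∀ i → Parity k (2 + i * 2)

parity : ∀ k {a} → 1 ≤ a → a ≤ 2 + k * 2 → Parity k a
parity k {1} _ _ = odd 0 refl
parity k {2} _ _ = even 0
parity (suc k) {suc (suc (suc a))} _ (s≤s (s≤s a≤)) with parity k {suc a} (s≤s z≤n) a≤
... | odd i eq = odd (suc i) (cong suc eq)
... | even i   = even (suc i)
parity zero {suc (suc (suc a))} _ (s≤s (s≤s ()))

-- An odd label lies below the even bound, an even one above 1, so `join` applies either way. If `a`
-- is 1 or the bound itself, a further path through a fresh node arises, and no arc is repeated.
link : ∀ k (C : Scheme []) → 2 + k * 2 ∈ nodes C → Linked C 1 (2 + k * 2) →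
       ∀ {a} → a ∈ nodes C → Parity k a → Σ (Scheme []) λ D → C ⊑ D × Linked D 1 a
link k C c∈ 1~c a∈ (odd i {j} refl) =
  let D , C⊑D , a~c = join C i j a∈ c∈
  in D , C⊑D , Eq.transitive _ (Linked-mono C⊑D 1~c) (Eq.symmetric _ a~c)
link k C c∈ 1~c a∈ (even i) = join C 0 i (1∈nodes C) a∈

-- The list `as` stays fixed while the scheme grows; links made earlier survive by `Linked-mono`.
linkAll : ∀ k (C : Scheme []) → 2 + k * 2 ∈ nodes C → Linked C 1 (2 + k * 2) →
          ∀ as → as ⊆ nodes C → All (Parity k) as →
          Σ (Scheme []) λ D → C ⊑ D × (∀ {a} → a ∈ as → Linked D 1 a)
linkAll k C c∈ 1~c []       as⊆ []       = C , ⊑-refl , λ ()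
linkAll k C c∈ 1~c (a ∷ as) as⊆ (p ∷ ps) =
  let D , C⊑D , 1~a = link k C c∈ 1~c (as⊆ (here refl)) p
      E , D⊑E , 1~as = linkAll k D (nodes⊆ C⊑D c∈) (Linked-mono C⊑D 1~c) as (nodes⊆ C⊑D ∘ as⊆ ∘ there) ps
  in E , ⊑-trans C⊑D D⊑E , λ { (here refl) → Linked-mono D⊑E 1~a ; (there a∈) → 1~as a∈ }

∈-bounds : (C : Scheme []) → ∀ {a} → a ∈ nodes C → 1 ≤ a × a ≤ top C
∈-bounds C a∈ = Equivalence.to ∈-segment (∈-resp-↭ (fills C) (∈-++⁺ˡ a∈))

-- It suffices to link the nodes of `C` to 1: every node created on the way is linked to one of
-- these by `hangs`.
connect : ∀ k (C : Scheme []) → top C ≡ 2 + k * 2 → 2 + k * 2 ∈ nodes C →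
          Σ (Scheme []) λ D → C ⊑ D × (∀ {y} → y ∈ nodes D → Linked D 1 y)
connect k C top≡ c∈ =
  -- With `i = 0` and `j = k` the two ends are 1 and the even bound.
  let D , C⊑D , 1~c = join C 0 k (1∈nodes C) c∈
      E , D⊑E , 1~as = linkAll k D (nodes⊆ C⊑D c∈) 1~c (nodes C) (nodes⊆ C⊑D)
        (All.tabulate λ a∈ → let 1≤a , a≤ = ∈-bounds C a∈ in parity k 1≤a (subst (_ ≤_) top≡ a≤))
      C⊑E = ⊑-trans C⊑D D⊑E
  in E , C⊑E , λ y∈ → let x , x∈ , x~y = hangs C⊑E y∈ in Eq.transitive _ (1~as x∈) x~y

-- From a scheme without gaps to a supergraceful graph.

module Realization (C : Scheme []) where

  private
    ns = nodes C
    es = arcs C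

    Adjacent : ℕ → ℕ → Set
    Adjacent = SymClosure (Arc es)

    valued-unique : Unique (ns ++ map dist es)
    valued-unique = Unique-resp-↭ (↭-sym (fills C)) (segment-unique (top C))

    arc⇒dist>0 : ∀ {x y} → (x , y) ∈ es → 1 ≤ dist (x , y)
    arc⇒dist>0 e = proj₁ (Equivalence.to ∈-segment (∈-resp-↭ (fills C) (∈-++⁺ʳ ns (∈-map⁺ dist e))))

    -- A loop would have difference 0, while `fills` makes every difference positive.
    Adjacent-irrefl : ∀ {x} → ¬ Adjacent x x
    Adjacent-irrefl {x} (fwd e) = <-irrefl (sym (∣n-n∣≡0 x)) (arc⇒dist>0 e)
    Adjacent-irrefl {x} (bwd e) = <-irrefl (sym (∣n-n∣≡0 x)) (arc⇒dist>0 e)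

    adjacent? : ∀ x y → Dec (Adjacent x y)
    adjacent? x y = map′ [ fwd , bwd ]′ (λ { (fwd e) → inj₁ e ; (bwd e) → inj₂ e })
                      (((x , y) Pair.∈? es) ⊎-dec ((y , x) Pair.∈? es))

  graph : Graph
  graph = record
    { order    = length ns
    ; _~_      = λ u v → Adjacent (lookup ns u) (lookup ns v)
    ; ~-sym    = Sym.symmetric _
    ; ~-irrefl = λ { refl → Adjacent-irrefl }
    ; _~?_     = λ u v → adjacent? (lookup ns u) (lookup ns v)
    }

  at : ∀ {x} → x ∈ ns → Vertex graph
  at = index

  lookup-inj : ∀ {u v : Vertex graph} → lookup ns u ≡ lookup ns v → u ≡ v
  lookup-inj = lookup-injective (Unique-++⁻ˡ ns valued-unique)

  labeling : Labeling graph
  labeling = record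
    { label    = lookup ns
    ; positive = λ v → proj₁ (∈-bounds C (∈-lookup v))
    }

  private
    ends : Vertex graph × Vertex graph → ℕ × ℕ
    ends (u , v) = lookup ns u , lookup ns v

    -- Edges are oriented by position in `ns`, arcs independently of it, so the two correspond only
    -- up to reversal. The absolute difference does not notice this.
    edge⇒arc : ∀ {e} → e ∈ edges graph → ∃[ a ] a ∈ es × dist (ends e) ≡ dist a
    edge⇒arc {u , v} e∈ with proj₂ (Equivalence.to (∈-edges graph) e∈)
    ... | fwd a = _ , a , refl
    ... | bwd a = _ , a , ∣-∣-comm (lookup ns u) _

    arc⇒edge : ∀ {a} → a ∈ es → ∃[ e ] e ∈ edges graph × dist a ≡ dist (ends e)
    arc⇒edge {x , y} a∈ with endpoints C a∈
    ... | x∈ , y∈ with lookup-index x∈ | lookup-index y∈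
    ... | x≡ | y≡ with Fin.<-cmp (at x∈) (at y∈)
    ... | tri< i<j _ _ = _ , Equivalence.from (∈-edges graph) (i<j , subst₂ Adjacent x≡ y≡ (fwd a∈))
                           , cong₂ ∣_-_∣ x≡ y≡
    ... | tri≈ _ i≡j _ = ⊥-elim (Adjacent-irrefl
      (subst (Adjacent x) (sym (trans x≡ (trans (cong (lookup ns) i≡j) (sym y≡)))) (fwd a∈)))
    ... | tri> _ _ j<i = _ , Equivalence.from (∈-edges graph) (j<i , subst₂ Adjacent y≡ x≡ (bwd a∈))
                           , trans (∣-∣-comm x y) (cong₂ ∣_-_∣ y≡ x≡)

    -- By `fills` an arc is determined by its difference, so both edges come from one arc. If they
    -- read it in opposite directions, then u = v′ and v = u′, against u < v and u′ < v′.
    adjacent-unique : ∀ {u v u′ v′} → u Fin.< v → u′ Fin.< v′ →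
      Adjacent (lookup ns u) (lookup ns v) → Adjacent (lookup ns u′) (lookup ns v′) →
      dist (ends (u , v)) ≡ dist (ends (u′ , v′)) → (u , v) ≡ (u′ , v′)
    adjacent-unique {u} {v} {u′} {v′} u<v u′<v′ a a′ eq = cases a a′
      where
      inj : ∀ {a a′} → a ∈ es → a′ ∈ es → dist a ≡ dist a′ → a ≡ a′
      inj = Unique-map-injective (Unique-++⁻ʳ ns valued-unique)
      same : (lookup ns u , lookup ns v) ≡ (lookup ns u′ , lookup ns v′) → (u , v) ≡ (u′ , v′)
      same p = let p₁ , p₂ = ,-injective p in cong₂ _,_ (lookup-inj p₁) (lookup-inj p₂)
      crossed : (lookup ns u , lookup ns v) ≡ (lookup ns v′ , lookup ns u′) → (u , v) ≡ (u′ , v′)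
      crossed p with ,-injective p
      ... | p₁ , p₂ with lookup-inj {u} {v′} p₁ | lookup-inj {v} {u′} p₂
      ... | refl | refl = ⊥-elim (Fin.<-asym u<v u′<v′)
      swap₁ = ∣-∣-comm (lookup ns v) (lookup ns u)
      swap₂ = ∣-∣-comm (lookup ns u′) (lookup ns v′)
      cases : Adjacent (lookup ns u) (lookup ns v) → Adjacent (lookup ns u′) (lookup ns v′) → (u , v) ≡ (u′ , v′)
      cases (fwd a) (fwd a′) = same (inj a a′ eq)
      cases (fwd a) (bwd a′) = crossed (inj a a′ (trans eq swap₂))
      cases (bwd a) (fwd a′) =
        let p₁ , p₂ = ,-injective (inj a a′ (trans swap₁ eq)) in crossed (cong₂ _,_ p₂ p₁)
      cases (bwd a) (bwd a′) =
        let p₁ , p₂ = ,-injective (inj a a′ (trans swap₁ (trans eq swap₂))) in same (cong₂ _,_ p₂ p₁)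

    edgeLabels-unique : Unique (edgeLabels labeling)
    edgeLabels-unique = Unique-map⁺ (λ e∈ e′∈ →
      let u<v , a = Equivalence.to (∈-edges graph) e∈
          u′<v′ , a′ = Equivalence.to (∈-edges graph) e′∈
      in adjacent-unique u<v u′<v′ a a′) (edges-unique graph)

    edgeLabels↭ : edgeLabels labeling ↭ map dist es
    edgeLabels↭ = unique∧set⇒↭ edgeLabels-unique (Unique-++⁻ʳ ns valued-unique)
      (λ z∈ → let e , e∈ , eq = ∈-map⁻ _ z∈
                  a , a∈ , eq′ = edge⇒arc e∈
              in subst (_∈ map dist es) (sym (trans eq eq′)) (∈-map⁺ dist a∈))
      (λ z∈ → let a , a∈ , eq = ∈-map⁻ dist z∈
                  e , e∈ , eq′ = arc⇒edge a∈
              in subst (_∈ edgeLabels labeling) (sym (trans eq eq′)) (∈-map⁺ (dist ∘ ends) e∈))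

    nodeLabels≡ : nodeLabels labeling ≡ ns
    nodeLabels≡ = trans (map-tabulate id (lookup ns)) (tabulate-lookup ns)

    labels↭ : labels labeling ↭ segment (top C)
    labels↭ = begin
      nodeLabels labeling ++ edgeLabels labeling ≡⟨ cong (_++ edgeLabels labeling) nodeLabels≡ ⟩
      ns ++ edgeLabels labeling                  ↭⟨ ++⁺ˡ ns edgeLabels↭ ⟩
      ns ++ map dist es                          ↭⟨ fills C ⟩
      segment (top C)                            ∎
      where open PermutationReasoning

    -- Both sides count the same labels, since `labels↭` rearranges the node and edge labels into
    -- the segment.
    order+size : order graph + size graph ≡ top C
    order+size = begin
      order graph + size graph
        ≡⟨ cong₂ _+_ (cong length nodeLabels≡) (length-map (dist ∘ ends) (edges graph)) ⟨
      length (nodeLabels labeling) + length (edgeLabels labeling)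
        ≡⟨ length-++ (nodeLabels labeling) ⟨
      length (labels labeling)
        ≡⟨ ↭-length labels↭ ⟩
      length (segment (top C))
        ≡⟨ length-applyDownFrom suc (top C) ⟩
      top C ∎
      where open ≡-Reasoning

  supergraceful : Supergraceful graph
  supergraceful = labeling , Unique-resp-↭ (↭-sym labels↭) (segment-unique (top C)) , λ k →
    subst (λ t → k ∈ labels labeling ⇔ (1 ≤ k × k ≤ t)) (sym order+size)
      (mk⇔ (Equivalence.to ∈-segment ∘ ∈-resp-↭ labels↭)
           (∈-resp-↭ (↭-sym labels↭) ∘ Equivalence.from ∈-segment))

  -- Induction runs along the chain of labels, so the end vertices enter through equations. Each
  -- intermediate label ends an arc and hence belongs to some vertex.
  path : ∀ {x y} → Linked C x y → ∀ {u v} → x ≡ lookup ns u → y ≡ lookup ns v → Star (Graph._~_ graph) u v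
  path ε         {u} x≡ y≡ = subst (Star _ u) (lookup-inj (trans (sym x≡) y≡)) ε
  path (s ◅ ss) x≡ y≡ = subst₂ Adjacent x≡ (lookup-index z∈) s ◅ path ss (lookup-index z∈) y≡
    where
    target : ∀ {x y} → Adjacent x y → y ∈ ns
    target (fwd a) = proj₂ (endpoints C a)
    target (bwd a) = proj₁ (endpoints C a)
    z∈ = target s

  connected : (∀ {y} → y ∈ ns → Linked C 1 y) → Connected graph
  connected 1~ = nonempty (1∈nodes C) , λ u v →
    path (Eq.transitive _ (Eq.symmetric _ (1~ (∈-lookup u))) (1~ (∈-lookup v))) refl refl
    where
    nonempty : ∀ {x} {xs : List ℕ} → x ∈ xs → 0 < length xs
    nonempty (here _)  = s≤s z≤n
    nonempty (there _) = s≤s z≤n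

-- Completing the given labeling by isolated nodes.

module _ {G : Graph} (φ : Labeling G) {M : ℕ} (distinct : DistinctWithin φ M) (1∈ : 1 ∈ nodeLabels φ) where

  private
    -- This bound is even, as `connect` requires, and exceeds `M`. Hence `T` labels nothing in `G`
    -- and becomes an isolated node itself.
    T : ℕ
    T = 2 + M * 2

    M<T : M < T
    M<T = m<n⇒m<1+n (s≤s (m≤m*n M 2))

    missing? : ∀ k → Dec (k ∉ labels φ)
    missing? k = ¬? (k ∈? labels φ)

    missing : List ℕ
    missing = filter missing? (segment T)

    ends : Vertex G × Vertex G → ℕ × ℕ
    ends (u , v) = label φ u , label φ v

    missing-∉ : ∀ {k} → k ∈ missing → k ∉ labels φ
    missing-∉ k∈ = proj₂ (∈-filter⁻ missing? {xs = segment T} k∈)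

    unique : Unique (labels φ ++ missing)
    unique = Unique.++⁺ (proj₁ distinct) (Unique.filter⁺ missing? (segment-unique T))
               (λ (k∈ , k∈′) → missing-∉ k∈′ k∈)

    labels++missing↭ : labels φ ++ missing ↭ segment T
    labels++missing↭ = unique∧set⇒↭ unique (segment-unique T)
      ([ (λ k∈ → let 1≤k , k≤M = proj₂ distinct _ k∈ in
                 Equivalence.from ∈-segment (1≤k , ≤-trans k≤M (<⇒≤ M<T)))
       , (λ k∈ → proj₁ (∈-filter⁻ missing? {xs = segment T} k∈)) ]′ ∘ ∈-++⁻ (labels φ))
      from
      where
      from : ∀ {k} → k ∈ segment T → k ∈ labels φ ++ missing
      from {k} k∈ with k ∈? labels φ
      ... | yes k∈′ = ∈-++⁺ˡ k∈′
      ... | no  k∉  = ∈-++⁺ʳ (labels φ) (∈-filter⁺ missing? k∈ k∉)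

    ∈-nodeLabels : ∀ u → label φ u ∈ nodeLabels φ
    ∈-nodeLabels u = ∈-map⁺ (label φ) (∈-allFin u)

  -- Missing labels enter as nodes without arcs, so they bring no new differences and the segment is
  -- filled exactly.
  completion : Scheme []
  completion = record
    { nodes     = nodeLabels φ ++ missing
    ; arcs      = map ends (edges G)
    ; top       = T
    ; fills     = fills′
    ; endpoints = endpoints′
    ; 1∈nodes   = ∈-++⁺ˡ 1∈
    }
    where
    fills′ : (nodeLabels φ ++ missing) ++ map dist (map ends (edges G)) ↭ segment T
    fills′ = begin
      (nodeLabels φ ++ missing) ++ map dist (map ends (edges G))
        ≡⟨ cong ((nodeLabels φ ++ missing) ++_) (sym (map-∘ (edges G))) ⟩
      (nodeLabels φ ++ missing) ++ edgeLabels φ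
        ≡⟨ ++-assoc (nodeLabels φ) missing _ ⟩
      nodeLabels φ ++ missing ++ edgeLabels φ
        ↭⟨ ++⁺ˡ (nodeLabels φ) (++-comm missing _) ⟩
      nodeLabels φ ++ edgeLabels φ ++ missing
        ≡⟨ sym (++-assoc (nodeLabels φ) _ missing) ⟩
      labels φ ++ missing
        ↭⟨ labels++missing↭ ⟩
      segment T ∎
      where open PermutationReasoning
    endpoints′ : ∀ {x y} → (x , y) ∈ map ends (edges G) →
                 x ∈ nodeLabels φ ++ missing × y ∈ nodeLabels φ ++ missing
    endpoints′ e with (u , v) , _ , refl ← ∈-map⁻ ends e = ∈-++⁺ˡ (∈-nodeLabels u) , ∈-++⁺ˡ (∈-nodeLabels v)

  top∈completion : T ∈ nodes completion
  top∈completion = ∈-++⁺ʳ (nodeLabels φ) (∈-filter⁺ missing? (Equivalence.from ∈-segment (s≤s z≤n , ≤-refl))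
    (λ T∈ → <-irrefl refl (<-≤-trans M<T (proj₂ (proj₂ distinct _ T∈)))))

  label-injective : ∀ {u v} → label φ u ≡ label φ v → u ≡ v
  label-injective = Unique-map-injective (Unique-++⁻ˡ (nodeLabels φ) (proj₁ distinct)) (∈-allFin _) (∈-allFin _)

  -- Labels of `G` are at most `T`, so by `induced` an arc of `D` between two of them is already an
  -- arc of `completion`. Such an arc comes from an edge of `G`, and `label-injective` identifies
  -- its ends.
  ⊑⇒ContainsInduced : (D : Scheme []) → completion ⊑ D → ContainsInduced (Realization.graph D) G
  ⊑⇒ContainsInduced D C⊑D = embedding⇒ContainsInduced f f-injective (λ u v → mk⇔ to from)
    where
    open Realization D
    label∈ : ∀ u → label φ u ∈ nodes D
    label∈ u = nodes⊆ C⊑D (∈-++⁺ˡ (∈-nodeLabels u))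
    f : Vertex G → Vertex graph
    f u = at (label∈ u)
    label-f : ∀ u → label φ u ≡ lookup (nodes D) (f u)
    label-f u = lookup-index (label∈ u)
    f-injective : ∀ {u v} → f u ≡ f v → u ≡ v
    f-injective {u} {v} eq = label-injective
      (trans (label-f u) (trans (cong (lookup (nodes D)) eq) (sym (label-f v))))
    arc : ∀ {u v} → u Fin.< v → Graph._~_ G u v → (label φ u , label φ v) ∈ arcs D
    arc u<v u~v = arcs⊆ C⊑D (∈-map⁺ ends (Equivalence.from (∈-edges G) (u<v , u~v)))
    to : ∀ {u v} → Graph._~_ G u v → Graph._~_ graph (f u) (f v)
    to {u} {v} u~v = subst₂ (SymClosure (Arc (arcs D))) (label-f u) (label-f v) adjacent
      where
      adjacent : SymClosure (Arc (arcs D)) (label φ u) (label φ v)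
      adjacent with Fin.<-cmp u v
      ... | tri< u<v _ _ = fwd (arc u<v u~v)
      ... | tri≈ _ u≡v _ = ⊥-elim (Graph.~-irrefl G u≡v u~v)
      ... | tri> _ _ v<u = bwd (arc v<u (Graph.~-sym G u~v))
    unarc : ∀ {u v} → (label φ u , label φ v) ∈ arcs D → Graph._~_ G u v
    unarc {u} {v} a with ∈-map⁻ ends (induced C⊑D a (proj₂ (∈-bounds completion (∈-++⁺ˡ (∈-nodeLabels v)))))
    ... | e , e∈ , eq with ,-injective eq
    ... | u≡ , v≡ with label-injective u≡ | label-injective v≡
    ... | refl | refl = proj₂ (Equivalence.to (∈-edges G) e∈)
    from : ∀ {u v} → Graph._~_ graph (f u) (f v) → Graph._~_ G u v
    from {u} {v} a with subst₂ (SymClosure (Arc (arcs D))) (sym (label-f u)) (sym (label-f v)) a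
    ... | fwd e = unarc e
    ... | bwd e = Graph.~-sym G (unarc e)

theorem8p8 : (G : Graph) → ¬ Supergraceful G → (φ : Labeling G) → IsSemitotal φ → 1 ∈ nodeLabels φ →
    ∃[ H ] (Connected H × Supergraceful H × ContainsInduced H G)
theorem8p8 G _ φ (q₀ , _ , distinct) 1∈ =
  let C = completion φ distinct 1∈
      -- `k` is the bound on the labels of `φ`; the top of `C` is `2 + k * 2` by definition.
      D , C⊑D , 1~ = connect (order G + size G + q₀) C refl (top∈completion φ distinct 1∈)
      open Realization D
  in graph , connected 1~ , supergraceful , ⊑⇒ContainsInduced φ distinct 1∈ D C⊑D
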